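{- Let $G=(V,E)$ be a bipartite graph with $m=|E|$ edges and $B$ butterflies. Let $e$ be an edge chosen uniformly at random from $E$ and let $Y=B_e\cdot\frac m4$ (the return value of one iteration of the algorithm ESamp). Then $\mathrm{Var}[Y]\le\frac m4\,(B+p_E)$.
   Context: Graphs are finite, simple, bipartite. A butterfly is a $2\times2$ biclique (two vertices on each side of the bipartition, all four edges between them present). $B=B(G)$ is the number of butterflies in $G$ and $B_e$ is the number of butterflies containing the edge $e$. $p_E$ is the number of (unordered) pairs of distinct butterflies that share at least one edge; equivalently $p_E=p_{1e}+p_{1w}$, where $p_{1e}$ is the number of pairs sharing exactly two vertices and exactly one edge, and $p_{1w}$ the number of pairs sharing exactly three vertices and two edges (a wedge). -}

module Defs where

open import Level using (0ℓ)
open import Data.Nat.Base using (ℕ; NonZero)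
open import Data.Fin.Base using (Fin)
import Data.Fin.Properties as Fin
open import Data.Integer.Base using (+_)
open import Data.Rational.Base using (ℚ; 0ℚ; _/_; _+_; _-_; _*_)
open import Data.List.Base
  using (List; []; _∷_; _++_; map; foldr; filter; length; allFin; cartesianProduct)
open import Data.List.Relation.Unary.All using (All; all?)
open import Data.List.Relation.Unary.Any using (any?)
open import Data.List.Membership.Propositional using (_∈_; find; lose)
import Data.List.Membership.DecPropositional as DecMembership
open import Data.Product.Base using (∃-syntax; _×_; _,_; uncurry)
open import Data.Product.Properties using (≡-dec)
open import Function.Base using (_∘_)
open import Relation.Nullary.Decidable using (map′)
open import Relation.Binary.Core using (REL)
open import Relation.Binary.Definitions using (Decidable; DecidableEquality)
open import Relation.Unary using () renaming (Decidable to Decidable₁)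

fromℕ : ℕ → ℚ
fromℕ n = + n / 1

-- The pairs of entries at positions i < j. For a duplicate-free list, every
-- unordered pair of distinct elements is listed exactly once.
pairs : ∀ {a} {A : Set a} → List A → List (A × A)
pairs []       = []
pairs (x ∷ xs) = map (x ,_) xs ++ pairs xs

-- Expectation and variance of X(ω), where ω is drawn uniformly from the entries
-- of a nonempty (here always duplicate-free) list Ω.
module _ {a} {A : Set a} (Ω : List A) .{{_ : NonZero (length Ω)}} where

  𝔼[_] : (A → ℚ) → ℚ
  𝔼[ X ] = foldr _+_ 0ℚ (map X Ω) * (+ 1 / length Ω)

  Var[_] : (A → ℚ) → ℚ
  Var[ X ] = 𝔼[ (λ ω → (X ω - 𝔼[ X ]) * (X ω - 𝔼[ X ])) ]

-- V is the disjoint union of the two sides Fin left and Fin right. An edge is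
-- written with its left endpoint first, so each edge is a single pair.
record BipartiteGraph : Set₁ where
  field
    left right : ℕ
    Adj        : REL (Fin left) (Fin right) 0ℓ
    adj?       : Decidable Adj

  VertexPair : Set
  VertexPair = Fin left × Fin right

  _≟_ : DecidableEquality VertexPair
  _≟_ = ≡-dec Fin._≟_ Fin._≟_

  open DecMembership _≟_ using (_∈?_)

  edges : List VertexPair
  edges = filter (uncurry adj?) (cartesianProduct (allFin left) (allFin right))

  m : ℕ
  m = length edges

  -- Two left vertices together with two right vertices.
  Quad : Set
  Quad = (Fin left × Fin left) × (Fin right × Fin right)

  edgesOf : Quad → List VertexPair
  edgesOf ((u , u′) , (v , v′)) = (u , v) ∷ (u , v′) ∷ (u′ , v) ∷ (u′ , v′) ∷ []

  IsBiclique : Quad → Set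
  IsBiclique = All (uncurry Adj) ∘ edgesOf

  isBiclique? : Decidable₁ IsBiclique
  isBiclique? = all? (uncurry adj?) ∘ edgesOf

  butterflies : List Quad
  butterflies =
    filter isBiclique? (cartesianProduct (pairs (allFin left)) (pairs (allFin right)))

  B : ℕ
  B = length butterflies

  Bₑ : VertexPair → ℕ
  Bₑ e = length (filter (λ β → e ∈? edgesOf β) butterflies)

  ShareEdge : Quad × Quad → Set
  ShareEdge (β , β′) = ∃[ e ] (e ∈ edgesOf β × e ∈ edgesOf β′)

  shareEdge? : Decidable₁ ShareEdge
  shareEdge? (β , β′) = map′ find (λ (_ , p , q) → lose p q)
                              (any? (_∈? edgesOf β′) (edgesOf β))

  pE : ℕ
  pE = length (filter shareEdge? (pairs butterflies))

  Y : VertexPair → ℚ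
  Y e = fromℕ (Bₑ e) * (+ m / 4)

-- Var[Y] ≤ 𝔼[Y²] = (m/16) Σₑ Bₑ². Since Bₑ² is Bₑ plus twice the number of pairs of
-- distinct butterflies containing e, counting incidences the other way round gives
-- Σₑ Bₑ² ≤ 4B + 4pE: a butterfly has four edges, and two distinct butterflies share at most
-- two, because on a side where their vertex pairs differ these meet in at most one vertex.

module Submission where

open import Data.Nat.Base using (NonZero)
open import Data.Integer.Base using (+_)
open import Data.Rational.Base using (_≤_; _+_; _*_; _/_)
open import Defs

open import Data.Empty using (⊥)
open import Data.Fin.Base as Fin using (Fin)
import Data.Fin.Properties as Fin
open import Data.Integer.Base as ℤ using ()
import Data.Integer.Properties as ℤ
open import Data.List.Base
  using (List; []; _∷_; _++_; map; foldr; filter; length; allFin; cartesianProduct)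
open import Data.List.Membership.Propositional using (_∈_)
import Data.List.Membership.DecPropositional as DecMembership
open import Data.List.Membership.Propositional.Properties
  using (∈-∃++; ∈-++⁺ˡ; ∈-++⁺ʳ; ∈-++⁻; ∈-map⁻; ∈-filter⁻; ∈-cartesianProduct⁺; ∈-cartesianProduct⁻)
open import Data.List.Properties using (length-++; filter-++; filter-reject; map-cong)
open import Data.List.Relation.Binary.Subset.Propositional using (_⊆_)
open import Data.List.Relation.Unary.All as All using (All; []; _∷_)
import Data.List.Relation.Unary.All.Properties as All
open import Data.List.Relation.Unary.AllPairs using (AllPairs; []; _∷_)
import Data.List.Relation.Unary.AllPairs.Properties as AllPairs
open import Data.List.Relation.Unary.Any using (here; there)
open import Data.List.Relation.Unary.Unique.Propositional using (Unique)
import Data.List.Relation.Unary.Unique.Propositional.Properties as Unique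
open import Data.Nat.Base as ℕ using (ℕ; suc; z≤n; s≤s)
open import Data.Nat.ListAction using (sum)
import Data.Nat.Properties as ℕ
open import Algebra.Properties.CommutativeSemigroup ℕ.+-commutativeSemigroup using (x∙yz≈y∙xz)
open import Data.Nat.Tactic.RingSolver using (solve-∀)
open import Data.Product.Base using (∃-syntax; _×_; _,_; proj₁; proj₂; uncurry)
open import Data.Product.Properties using (≡-dec; ,-injectiveʳ)
open import Data.Rational.Base as ℚ using (ℚ; 0ℚ; 1ℚ; _-_; fromℚᵘ; toℚᵘ)
import Data.Rational.Properties as ℚ
open import Data.Rational.Solver using (module +-*-Solver)
open import Data.Rational.Unnormalised.Base as ℚᵘ using (mkℚᵘ; *≡*)
import Data.Rational.Unnormalised.Properties as ℚᵘ
open import Data.Sum.Base using (inj₁; inj₂)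
open import Function.Base using (_∘_)
open import Level using (Level)
open import Relation.Binary.Core using (Rel; REL)
import Relation.Binary.Definitions as Binary
open import Relation.Binary.PropositionalEquality
open import Relation.Nullary.Decidable using (yes; no; _×-dec_)
open import Relation.Nullary.Negation using (¬_; contradiction)
open import Relation.Unary using (Pred; Decidable)

private variable
  a b p q ℓ : Level
  A : Set a
  C : Set b

-- Sums, counts and pairs in lists

sum-map-+2* : (f g : A → ℕ) (xs : List A) →
  sum (map (λ x → f x ℕ.+ 2 ℕ.* g x) xs) ≡ sum (map f xs) ℕ.+ 2 ℕ.* sum (map g xs)
sum-map-+2* f g []       = refl
sum-map-+2* f g (x ∷ xs) = trans (cong (f x ℕ.+ 2 ℕ.* g x ℕ.+_) (sum-map-+2* f g xs))
  (interchange (f x) (g x) (sum (map f xs)) (sum (map g xs)))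
  where
  interchange : ∀ a b c d → a ℕ.+ 2 ℕ.* b ℕ.+ (c ℕ.+ 2 ℕ.* d) ≡ a ℕ.+ c ℕ.+ 2 ℕ.* (b ℕ.+ d)
  interchange = solve-∀

count : {P : Pred A p} → Decidable P → List A → ℕ
count P? = length ∘ filter P?

-- Each head `x` of `xs` is cut out of `ys`; since `x` does not recur in the tail of `xs`, the tail
-- stays inside what is left.
length-mono-⊆ : {xs ys : List A} → Unique xs → xs ⊆ ys → length xs ℕ.≤ length ys
length-mono-⊆ {xs = []}     []           _  = z≤n
length-mono-⊆ {xs = x ∷ xs} (x∉xs ∷ xs!) xs⊆ys with ∈-∃++ (xs⊆ys (here refl))
... | as , bs , refl = begin
  suc (length xs)              ≤⟨ s≤s (length-mono-⊆ xs! xs⊆as++bs) ⟩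
  suc (length (as ++ bs))      ≡⟨ cong suc (length-++ as) ⟩
  suc (length as ℕ.+ length bs) ≡⟨ ℕ.+-suc (length as) (length bs) ⟨
  length as ℕ.+ suc (length bs) ≡⟨ length-++ as ⟨
  length (as ++ x ∷ bs)        ∎
  where
  open ℕ.≤-Reasoning
  xs⊆as++bs : xs ⊆ as ++ bs
  xs⊆as++bs y∈xs with ∈-++⁻ as (xs⊆ys (there y∈xs))
  ... | inj₁ y∈as         = ∈-++⁺ˡ y∈as
  ... | inj₂ (here refl)  = contradiction refl (All.lookup x∉xs y∈xs)
  ... | inj₂ (there y∈bs) = ∈-++⁺ʳ as y∈bs

-- Lets the pairs of butterflies with a given common edge be counted inside the list of all sharing
-- pairs.
filter-filter : {P : Pred A p} {Q : Pred A q} (P? : Decidable P) (Q? : Decidable Q) →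
                (∀ {x} → P x → Q x) → ∀ xs → filter P? (filter Q? xs) ≡ filter P? xs
filter-filter P? Q? P⇒Q [] = refl
filter-filter P? Q? P⇒Q (x ∷ xs) with Q? x
... | no ¬q = trans (filter-filter P? Q? P⇒Q xs) (sym (filter-reject P? (¬q ∘ P⇒Q)))
... | yes _ with P? x
...   | yes _ = cong (x ∷_) (filter-filter P? Q? P⇒Q xs)
...   | no  _ = filter-filter P? Q? P⇒Q xs

AllPairs⇒All-pairs : {R : Rel A ℓ} {xs : List A} → AllPairs R xs → All (uncurry R) (pairs xs)
AllPairs⇒All-pairs []         = []
AllPairs⇒All-pairs (xR ∷ xsR) = All.++⁺ (All.map⁺ xR) (AllPairs⇒All-pairs xsR)

∈-pairs⁻₁ : (xs : List A) {xy : A × A} → xy ∈ pairs xs → proj₁ xy ∈ xs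
∈-pairs⁻₁ (x ∷ xs) xy∈ with ∈-++⁻ (map (x ,_) xs) xy∈
... | inj₂ xy∈pairs = there (∈-pairs⁻₁ xs xy∈pairs)
... | inj₁ xy∈map with _ , _ , refl ← ∈-map⁻ (x ,_) xy∈map = here refl

-- The block of pairs headed by `x` is disjoint from `pairs xs`, whose first components lie in `xs`
-- and so differ from `x`.
pairs-unique : {xs : List A} → Unique xs → Unique (pairs xs)
pairs-unique [] = []
pairs-unique {xs = x ∷ xs} (x∉xs ∷ xs!) =
  Unique.++⁺ (Unique.map⁺ ,-injectiveʳ xs!) (pairs-unique xs!) disjoint
  where
  disjoint : ∀ {xy} → xy ∈ map (x ,_) xs × xy ∈ pairs xs → ⊥
  disjoint (xy∈map , xy∈pairs) with _ , _ , refl ← ∈-map⁻ (x ,_) xy∈map =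
    All.lookup x∉xs (∈-pairs⁻₁ xs xy∈pairs) refl

module _ {P : Pred A p} (P? : Decidable P) where

  both? : Decidable {A = A × A} (λ (x , y) → P x × P y)
  both? (x , y) = P? x ×-dec P? y

  count-both-map-accept : ∀ {x} → P x → ∀ xs → count both? (map (x ,_) xs) ≡ count P? xs
  count-both-map-accept px [] = refl
  count-both-map-accept {x} px (y ∷ ys) with P? x | P? y
  ... | yes _  | yes _ = cong suc (count-both-map-accept px ys)
  ... | yes _  | no  _ = count-both-map-accept px ys
  ... | no ¬px | _     = contradiction px ¬px

  count-both-map-reject : ∀ {x} → ¬ P x → ∀ xs → count both? (map (x ,_) xs) ≡ 0
  count-both-map-reject ¬px [] = refl
  count-both-map-reject {x} ¬px (y ∷ ys) with P? x
  ... | yes px = contradiction px ¬px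
  ... | no _   = count-both-map-reject ¬px ys

  count-both-pairs-∷ : ∀ x xs {k} → count both? (map (x ,_) xs) ≡ k →
                       count both? (pairs (x ∷ xs)) ≡ k ℕ.+ count both? (pairs xs)
  count-both-pairs-∷ x xs {k} eq = begin
    count both? (map (x ,_) xs ++ pairs xs)
      ≡⟨ cong length (filter-++ both? (map (x ,_) xs) (pairs xs)) ⟩
    length (filter both? (map (x ,_) xs) ++ filter both? (pairs xs))
      ≡⟨ length-++ (filter both? (map (x ,_) xs)) ⟩
    count both? (map (x ,_) xs) ℕ.+ count both? (pairs xs)
      ≡⟨ cong (ℕ._+ count both? (pairs xs)) eq ⟩
    k ℕ.+ count both? (pairs xs) ∎
    where open ≡-Reasoning

  -- With `n` accepted positions, `n * n` counts ordered pairs of them: `n` on the diagonal, the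
  -- others in two orders each. In the induction an accepted head forms `n` new pairs, matching the
  -- growth `2n + 1` of the square.
  count-square : ∀ xs → count P? xs ℕ.* count P? xs ≡ count P? xs ℕ.+ 2 ℕ.* count both? (pairs xs)
  count-square [] = refl
  count-square (x ∷ xs) with P? x
  ... | no ¬px = trans (count-square xs)
    (cong (λ k → count P? xs ℕ.+ 2 ℕ.* k)
      (sym (count-both-pairs-∷ x xs (count-both-map-reject ¬px xs))))
  ... | yes px = begin
    suc n ℕ.* suc n                   ≡⟨ expand n ⟩
    suc (2 ℕ.* n) ℕ.+ n ℕ.* n         ≡⟨ cong (suc (2 ℕ.* n) ℕ.+_) (count-square xs) ⟩
    suc (2 ℕ.* n) ℕ.+ (n ℕ.+ 2 ℕ.* k) ≡⟨ collect n k ⟩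
    suc n ℕ.+ 2 ℕ.* (n ℕ.+ k)         ≡⟨ cong (λ t → suc n ℕ.+ 2 ℕ.* t)
                                           (count-both-pairs-∷ x xs (count-both-map-accept px xs)) ⟨
    suc n ℕ.+ 2 ℕ.* count both? (pairs (x ∷ xs)) ∎
    where
    open ≡-Reasoning
    n = count P? xs
    k = count both? (pairs xs)
    expand : ∀ n → suc n ℕ.* suc n ≡ suc (2 ℕ.* n) ℕ.+ n ℕ.* n
    expand = solve-∀
    collect : ∀ n k → suc (2 ℕ.* n) ℕ.+ (n ℕ.+ 2 ℕ.* k) ≡ suc n ℕ.+ 2 ℕ.* (n ℕ.+ k)
    collect = solve-∀

module _ {R : REL A C ℓ} (R? : Binary.Decidable R) where

  sum-count-∷ : ∀ y ys xs → sum (map (λ x → count (R? x) (y ∷ ys)) xs) ≡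
                count (λ x → R? x y) xs ℕ.+ sum (map (λ x → count (R? x) ys) xs)
  sum-count-∷ y ys [] = refl
  sum-count-∷ y ys (x ∷ xs) with R? x y
  ... | yes _ = cong suc (trans (cong (count (R? x) ys ℕ.+_) (sum-count-∷ y ys xs))
                                (x∙yz≈y∙xz (count (R? x) ys) (count (λ x → R? x y) xs) _))
  ... | no _  = trans (cong (count (R? x) ys ℕ.+_) (sum-count-∷ y ys xs))
                      (x∙yz≈y∙xz (count (R? x) ys) (count (λ x → R? x y) xs) _)

  -- Both sides concern the incidences between `xs` and `ys`: summed over `xs` on the left, bounded
  -- by `k` for each entry of `ys` on the right.
  double-counting : ∀ k xs {ys} → All (λ y → count (λ x → R? x y) xs ℕ.≤ k) ys →
                    sum (map (λ x → count (R? x) ys) xs) ℕ.≤ length ys ℕ.* k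
  double-counting k xs {[]} [] = ℕ.≤-reflexive (sum-zero xs)
    where
    sum-zero : ∀ xs → sum (map (λ x → count (R? x) []) xs) ≡ 0
    sum-zero []       = refl
    sum-zero (_ ∷ xs) = sum-zero xs
  double-counting k xs {y ∷ ys} (≤k ∷ ≤ks) = begin
    sum (map (λ x → count (R? x) (y ∷ ys)) xs)                       ≡⟨ sum-count-∷ y ys xs ⟩
    count (λ x → R? x y) xs ℕ.+ sum (map (λ x → count (R? x) ys) xs) ≤⟨ ℕ.+-mono-≤ ≤k (double-counting k xs ≤ks) ⟩
    k ℕ.+ length ys ℕ.* k                                            ∎
    where open ℕ.≤-Reasoning

-- Edges common to two butterflies

-- Two common entries would make the pairs equal as sets, and increasing pairs that are equal as
-- sets are equal as tuples.
distinct-pairs-meet-in-≤1 : ∀ {n} {u u′ w w′ : Fin n} → u Fin.< u′ → w Fin.< w′ →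
  (u , u′) ≢ (w , w′) →
  ∃[ z ] (∀ {x} → x ∈ u ∷ u′ ∷ [] → x ∈ w ∷ w′ ∷ [] → x ≡ z)
distinct-pairs-meet-in-≤1 {u = u} {u′} {w} {w′} u<u′ w<w′ ≢ with u ∈? (w ∷ w′ ∷ [])
  where open DecMembership Fin._≟_ using (_∈?_)
-- With `u` excluded, `u′` is the only candidate; it also serves as a default when the pairs are
-- disjoint.
... | no u∉ = u′ , λ where
  (here refl)         u∈ → contradiction u∈ u∉
  (there (here refl)) _  → refl
... | yes (here refl) = u , λ where
  (here refl)         _                   → refl
  (there (here refl)) (here refl)         → refl
  (there (here refl)) (there (here refl)) → contradiction refl ≢
... | yes (there (here refl)) = u , λ where
  (here refl)         _                   → refl
  -- Here `u` is `w′` and `u′` is `w`, so the two strict orders oppose each other.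
  (there (here refl)) (here refl)         → contradiction u<u′ (ℕ.<-asym w<w′)
  (there (here refl)) (there (here refl)) → refl

module Butterflies (G : BipartiteGraph) where
  open BipartiteGraph G
  open DecMembership _≟_ using (_∈?_)

  -- A normal form for quads: increasing sides make distinct tuples distinct as vertex sets.
  Ordered : Quad → Set
  Ordered ((u , u′) , (v , v′)) = u Fin.< u′ × v Fin.< v′

  allFin-pairs-< : ∀ n → All (uncurry Fin._<_) (pairs (allFin n))
  allFin-pairs-< n = AllPairs⇒All-pairs (AllPairs.tabulate⁺-< λ i<j → i<j)

  butterflies-ordered : All Ordered butterflies
  butterflies-ordered = All.tabulate λ β∈ →
    let l∈ , r∈ = ∈-cartesianProduct⁻ (pairs (allFin left)) (pairs (allFin right))
                    (proj₁ (∈-filter⁻ isBiclique? β∈))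
    in All.lookup (allFin-pairs-< left) l∈ , All.lookup (allFin-pairs-< right) r∈

  edges-unique : Unique edges
  edges-unique = Unique.filter⁺ (uncurry adj?)
    (Unique.cartesianProduct⁺ (Unique.allFin⁺ left) (Unique.allFin⁺ right))

  butterflies-unique : Unique butterflies
  butterflies-unique = Unique.filter⁺ isBiclique?
    (Unique.cartesianProduct⁺ (pairs-unique (Unique.allFin⁺ left)) (pairs-unique (Unique.allFin⁺ right)))

  -- As `edges` has no duplicates, any list `es` of candidates gives a bound. Four candidates are
  -- supplied for one butterfly, two for the edges common to a pair.
  count-edges≤ : {P : Pred VertexPair p} (P? : Decidable P) (es : List VertexPair) →
                 (∀ {e} → P e → e ∈ es) → count P? edges ℕ.≤ length es
  count-edges≤ P? es P⇒∈ = length-mono-⊆ (Unique.filter⁺ P? edges-unique)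
    (P⇒∈ ∘ proj₂ ∘ ∈-filter⁻ P? {xs = edges})

  in-both? : ∀ e → Decidable (λ (β , β′) → e ∈ edgesOf β × e ∈ edgesOf β′)
  in-both? e = both? (λ β → e ∈? edgesOf β)

  -- On a side where the vertex pairs differ, all common edges have the same endpoint `z`; the two
  -- vertices of `β` on the other side leave two candidates.
  common-edges≤2 : ∀ {β β′} → Ordered β → Ordered β′ → β ≢ β′ →
                   count (λ e → in-both? e (β , β′)) edges ℕ.≤ 2
  common-edges≤2 {(u , u′) , (v , v′)} {(w , w′) , (t , t′)} (u<u′ , v<v′) (w<w′ , t<t′) β≢β′
    with ≡-dec Fin._≟_ Fin._≟_ (u , u′) (w , w′)
  ... | no ≢ˡ =
    let z , only-z = distinct-pairs-meet-in-≤1 u<u′ w<w′ ≢ˡ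
    in count-edges≤ _ (cartesianProduct (z ∷ []) (v ∷ v′ ∷ [])) λ (e∈β , e∈β′) →
         -- `edgesOf` of a quad unfolds to the cartesian product of its two vertex pairs, so
         -- membership splits by endpoint.
         let x∈ , y∈ = ∈-cartesianProduct⁻ (u ∷ u′ ∷ []) (v ∷ v′ ∷ []) e∈β
             x∈′ , _ = ∈-cartesianProduct⁻ (w ∷ w′ ∷ []) (t ∷ t′ ∷ []) e∈β′
         in ∈-cartesianProduct⁺ {xs = z ∷ []} (here (only-z x∈ x∈′)) y∈
  ... | yes refl =
    -- The left pairs agree, so `β≢β′` makes the right pairs differ.
    let z , only-z = distinct-pairs-meet-in-≤1 v<v′ t<t′ (β≢β′ ∘ cong (_ ,_))
    in count-edges≤ _ (cartesianProduct (u ∷ u′ ∷ []) (z ∷ [])) λ (e∈β , e∈β′) →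
         let x∈ , y∈ = ∈-cartesianProduct⁻ (u ∷ u′ ∷ []) (v ∷ v′ ∷ []) e∈β
             _ , y∈′ = ∈-cartesianProduct⁻ (w ∷ w′ ∷ []) (t ∷ t′ ∷ []) e∈β′
         in ∈-cartesianProduct⁺ {ys = z ∷ []} x∈ (here (only-z y∈ y∈′))

  sharing : List (Quad × Quad)
  sharing = filter shareEdge? (pairs butterflies)

  sum-Bₑ≤ : sum (map Bₑ edges) ℕ.≤ B ℕ.* 4
  sum-Bₑ≤ = double-counting (λ e β → e ∈? edgesOf β) 4 edges
    (All.universal (λ β → count-edges≤ (λ e → e ∈? edgesOf β) (edgesOf β) (λ e∈ → e∈)) butterflies)

  -- Counts incidences between an edge and a sharing pair that has it in common, at most two per
  -- pair by `common-edges≤2`.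
  sum-sharing≤ : sum (map (λ e → count (in-both? e) sharing) edges) ℕ.≤ pE ℕ.* 2
  sum-sharing≤ = double-counting in-both? 2 edges (All.filter⁺ shareEdge? distinct)
    where
    distinct : All (λ ββ′ → count (λ e → in-both? e ββ′) edges ℕ.≤ 2) (pairs butterflies)
    distinct = AllPairs⇒All-pairs (go butterflies-ordered butterflies-unique)
      where
      go : ∀ {βs} → All Ordered βs → Unique βs →
           AllPairs (λ β β′ → count (λ e → in-both? e (β , β′)) edges ℕ.≤ 2) βs
      go []       []         = []
      go (o ∷ os) (≢s ∷ βs!) =
        All.zipWith (λ (o′ , ≢) → common-edges≤2 o o′ ≢) (os , ≢s) ∷ go os βs!

  Bₑ-square : ∀ e → Bₑ e ℕ.* Bₑ e ≡ Bₑ e ℕ.+ 2 ℕ.* count (in-both? e) sharing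
  Bₑ-square e = trans (count-square (λ β → e ∈? edgesOf β) butterflies)
    (cong (λ xs → Bₑ e ℕ.+ 2 ℕ.* length xs)
      -- The edge `e` itself witnesses that such a pair shares an edge.
      (sym (filter-filter (in-both? e) shareEdge? (e ,_) (pairs butterflies))))

  sum-Bₑ²≤ : sum (map (λ e → Bₑ e ℕ.* Bₑ e) edges) ℕ.≤ 4 ℕ.* (B ℕ.+ pE)
  sum-Bₑ²≤ = begin
    sum (map (λ e → Bₑ e ℕ.* Bₑ e) edges)       ≡⟨ cong sum (map-cong Bₑ-square edges) ⟩
    sum (map (λ e → Bₑ e ℕ.+ 2 ℕ.* count (in-both? e) sharing) edges)
      ≡⟨ sum-map-+2* Bₑ (λ e → count (in-both? e) sharing) edges ⟩
    sum (map Bₑ edges) ℕ.+ 2 ℕ.* sum (map (λ e → count (in-both? e) sharing) edges)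
      ≤⟨ ℕ.+-mono-≤ sum-Bₑ≤ (ℕ.*-monoʳ-≤ 2 sum-sharing≤) ⟩
    -- The weight 4 of `pE` is the 2 from `Bₑ-square` times the at most two common edges of a pair.
    B ℕ.* 4 ℕ.+ 2 ℕ.* (pE ℕ.* 2)                ≡⟨ collect B pE ⟩
    4 ℕ.* (B ℕ.+ pE)                            ∎
    where
    open ℕ.≤-Reasoning
    collect : ∀ b p → b ℕ.* 4 ℕ.+ 2 ℕ.* (p ℕ.* 2) ≡ 4 ℕ.* (b ℕ.+ p)
    collect = solve-∀

-- Natural numbers and fractions inside the rationals

-- Moves identities of `ℚ` to unnormalised fractions, where equality is cross-multiplication of
-- integers and no reduction to lowest terms intervenes.
fromℚᵘ-homo-+ : ∀ p q → fromℚᵘ (p ℚᵘ.+ q) ≡ fromℚᵘ p + fromℚᵘ q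
fromℚᵘ-homo-+ p q = ℚ.toℚᵘ-injective (begin
  toℚᵘ (fromℚᵘ (p ℚᵘ.+ q))              ≈⟨ ℚ.toℚᵘ-fromℚᵘ (p ℚᵘ.+ q) ⟩
  p ℚᵘ.+ q                              ≈⟨ ℚᵘ.+-cong (ℚ.toℚᵘ-fromℚᵘ p) (ℚ.toℚᵘ-fromℚᵘ q) ⟨
  toℚᵘ (fromℚᵘ p) ℚᵘ.+ toℚᵘ (fromℚᵘ q)  ≈⟨ ℚ.toℚᵘ-homo-+ (fromℚᵘ p) (fromℚᵘ q) ⟨
  toℚᵘ (fromℚᵘ p + fromℚᵘ q)            ∎)
  where open ℚᵘ.≃-Reasoning

fromℚᵘ-homo-* : ∀ p q → fromℚᵘ (p ℚᵘ.* q) ≡ fromℚᵘ p * fromℚᵘ q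
fromℚᵘ-homo-* p q = ℚ.toℚᵘ-injective (begin
  toℚᵘ (fromℚᵘ (p ℚᵘ.* q))              ≈⟨ ℚ.toℚᵘ-fromℚᵘ (p ℚᵘ.* q) ⟩
  p ℚᵘ.* q                              ≈⟨ ℚᵘ.*-cong (ℚ.toℚᵘ-fromℚᵘ p) (ℚ.toℚᵘ-fromℚᵘ q) ⟨
  toℚᵘ (fromℚᵘ p) ℚᵘ.* toℚᵘ (fromℚᵘ q)  ≈⟨ ℚ.toℚᵘ-homo-* (fromℚᵘ p) (fromℚᵘ q) ⟨
  toℚᵘ (fromℚᵘ p * fromℚᵘ q)            ∎)
  where open ℚᵘ.≃-Reasoning

fromℕ-homo-+ : ∀ j k → fromℕ (j ℕ.+ k) ≡ fromℕ j + fromℕ k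
fromℕ-homo-+ j k = trans
  -- `mkℚᵘ` stores the denominator less one, so 0 encodes the denominator 1 of `fromℕ`.
  (ℚ.fromℚᵘ-cong {x = mkℚᵘ (+ (j ℕ.+ k)) 0} {y = mkℚᵘ (+ j) 0 ℚᵘ.+ mkℚᵘ (+ k) 0}
    (*≡* (cong (ℤ._* + 1) (cong₂ ℤ._+_ (sym (ℤ.*-identityʳ (+ j))) (sym (ℤ.*-identityʳ (+ k)))))))
  (fromℚᵘ-homo-+ (mkℚᵘ (+ j) 0) (mkℚᵘ (+ k) 0))

fromℕ-homo-* : ∀ j k → fromℕ (j ℕ.* k) ≡ fromℕ j * fromℕ k
fromℕ-homo-* j k = trans
  (ℚ.fromℚᵘ-cong {x = mkℚᵘ (+ (j ℕ.* k)) 0} {y = mkℚᵘ (+ j) 0 ℚᵘ.* mkℚᵘ (+ k) 0}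
    (*≡* (cong (ℤ._* + 1) (ℤ.pos-* j k))))
  (fromℚᵘ-homo-* (mkℚᵘ (+ j) 0) (mkℚᵘ (+ k) 0))

fromℕ-nonNeg : ∀ n → ℚ.NonNegative (fromℕ n)
fromℕ-nonNeg n = ℚ.normalize-nonNeg n 1

p≤p+q : ∀ p q .{{_ : ℚ.NonNegative q}} → p ≤ p + q
p≤p+q p q = subst (_≤ p + q) (ℚ.+-identityʳ p) (ℚ.+-monoʳ-≤ p (ℚ.nonNegative⁻¹ q))

-- Writes `k` as `j` plus the nonnegative difference `k ∸ j`.
fromℕ-mono-≤ : ∀ {j k} → j ℕ.≤ k → fromℕ j ≤ fromℕ k
fromℕ-mono-≤ {j} {k} j≤k = subst (fromℕ j ≤_)
  (trans (sym (fromℕ-homo-+ j (k ℕ.∸ j))) (cong fromℕ (ℕ.m+[n∸m]≡n j≤k)))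
  (p≤p+q (fromℕ j) (fromℕ (k ℕ.∸ j)) {{fromℕ-nonNeg (k ℕ.∸ j)}})

fromℕ-inverse : ∀ n .{{_ : NonZero n}} → fromℕ n * (+ 1 / n) ≡ 1ℚ
fromℕ-inverse (suc n) = trans
  (sym (fromℚᵘ-homo-* (mkℚᵘ (+ suc n) 0) (mkℚᵘ (+ 1) n)))
  (ℚ.fromℚᵘ-cong {x = mkℚᵘ (+ suc n) 0 ℚᵘ.* mkℚᵘ (+ 1) n} {y = mkℚᵘ (+ 1) 0}
    (*≡* (cong +_ (eq n))))
  where
  eq : ∀ n → suc n ℕ.* 1 ℕ.* 1 ≡ 1 ℕ.* suc (n ℕ.+ 0)
  eq = solve-∀

n/4≡n*¼ : ∀ n → + n / 4 ≡ fromℕ n * (+ 1 / 4)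
n/4≡n*¼ n = trans
  (ℚ.fromℚᵘ-cong {x = mkℚᵘ (+ n) 3} {y = mkℚᵘ (+ n) 0 ℚᵘ.* mkℚᵘ (+ 1) 3}
    (*≡* (cong (ℤ._* + 4) (sym (ℤ.*-identityʳ (+ n))))))
  (fromℚᵘ-homo-* (mkℚᵘ (+ n) 0) (mkℚᵘ (+ 1) 3))

-- Matching on the sign of the numerator lets instance search find the sign of `p`.
square-nonNeg : ∀ p → ℚ.NonNegative (p * p)
square-nonNeg p@(ℚ.mkℚ (+ _) _ _)      = ℚ.nonNeg*nonNeg⇒nonNeg p p
square-nonNeg p@(ℚ.mkℚ ℤ.-[1+ _ ] _ _) = ℚ.nonPos*nonPos⇒nonPos p p

-- Variance and second moment

Σ[_] : List A → (A → ℚ) → ℚ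
Σ[ Ω ] X = foldr _+_ 0ℚ (map X Ω)

module _ (X : A → ℚ) where
  open +-*-Solver

  -- The expansion of the squares, with the cross term moved to the left. `μ` is an arbitrary
  -- constant, since the mean of the whole list must stay fixed while the induction shortens `Ω`.
  Σ-shifted-square : ∀ μ Ω → Σ[ Ω ] (λ ω → (X ω - μ) * (X ω - μ)) + (μ + μ) * Σ[ Ω ] X ≡
                     Σ[ Ω ] (λ ω → X ω * X ω) + fromℕ (length Ω) * (μ * μ)
  Σ-shifted-square μ [] = solve 1 (λ μ → con 0ℚ :+ (μ :+ μ) :* con 0ℚ := con 0ℚ :+ con 0ℚ :* (μ :* μ)) refl μ
  Σ-shifted-square μ (ω ∷ Ω) = begin
    ((x - μ) * (x - μ) + V) + (μ + μ) * (x + S)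
      ≡⟨ solve 4 (λ x μ V S → ((x :- μ) :* (x :- μ) :+ V) :+ (μ :+ μ) :* (x :+ S) :=
                              (x :* x :+ μ :* μ) :+ (V :+ (μ :+ μ) :* S)) refl x μ V S ⟩
    (x * x + μ * μ) + (V + (μ + μ) * S)
      ≡⟨ cong (λ t → (x * x + μ * μ) + t) (Σ-shifted-square μ Ω) ⟩
    (x * x + μ * μ) + (Q + N * (μ * μ))
      ≡⟨ solve 4 (λ x μ Q N → (x :* x :+ μ :* μ) :+ (Q :+ N :* (μ :* μ)) :=
                              (x :* x :+ Q) :+ (con 1ℚ :+ N) :* (μ :* μ)) refl x μ Q N ⟩
    (x * x + Q) + (1ℚ + N) * (μ * μ)
      ≡⟨ cong (λ k → (x * x + Q) + k * (μ * μ)) (fromℕ-homo-+ 1 (length Ω)) ⟨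
    (x * x + Q) + fromℕ (suc (length Ω)) * (μ * μ) ∎
    where
    open ≡-Reasoning
    x = X ω
    V = Σ[ Ω ] (λ ω → (X ω - μ) * (X ω - μ))
    S = Σ[ Ω ] X
    Q = Σ[ Ω ] (λ ω → X ω * X ω)
    N = fromℕ (length Ω)

  Var+𝔼²≡𝔼[X²] : ∀ Ω .{{_ : NonZero (length Ω)}} →
    Var[_] Ω X + 𝔼[_] Ω X * 𝔼[_] Ω X ≡ 𝔼[_] Ω (λ ω → X ω * X ω)
  Var+𝔼²≡𝔼[X²] Ω = begin
    V * r + μ * μ
      -- Adds and subtracts `(μ + μ) * (S * r)` to create the left side of `Σ-shifted-square`;
      -- `S * r` is `μ` by definition.
      ≡⟨ solve 4 (λ V S r μ → V :* r :+ μ :* μ :=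
           (V :+ (μ :+ μ) :* S) :* r :- (μ :+ μ) :* (S :* r) :+ μ :* μ) refl V S r μ ⟩
    (V + (μ + μ) * S) * r - (μ + μ) * μ + μ * μ
      ≡⟨ cong (λ k → k * r - (μ + μ) * μ + μ * μ) (Σ-shifted-square μ Ω) ⟩
    (Q + N * (μ * μ)) * r - (μ + μ) * μ + μ * μ
      ≡⟨ solve 4 (λ Q N r μ → (Q :+ N :* (μ :* μ)) :* r :- (μ :+ μ) :* μ :+ μ :* μ :=
           Q :* r :+ (N :* r :- con 1ℚ) :* (μ :* μ)) refl Q N r μ ⟩
    Q * r + (N * r - 1ℚ) * (μ * μ)
      ≡⟨ cong (λ k → Q * r + (k - 1ℚ) * (μ * μ)) (fromℕ-inverse (length Ω)) ⟩
    Q * r + (1ℚ - 1ℚ) * (μ * μ)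
      ≡⟨ solve 3 (λ Q r μ → Q :* r :+ (con 1ℚ :- con 1ℚ) :* (μ :* μ) := Q :* r) refl Q r μ ⟩
    Q * r ∎
    where
    open ≡-Reasoning
    r = + 1 / length Ω
    μ = 𝔼[_] Ω X
    V = Σ[ Ω ] (λ ω → (X ω - μ) * (X ω - μ))
    S = Σ[ Ω ] X
    Q = Σ[ Ω ] (λ ω → X ω * X ω)
    N = fromℕ (length Ω)

  Var≤𝔼[X²] : ∀ Ω .{{_ : NonZero (length Ω)}} → Var[_] Ω X ≤ 𝔼[_] Ω (λ ω → X ω * X ω)
  Var≤𝔼[X²] Ω = subst (Var[_] Ω X ≤_) (Var+𝔼²≡𝔼[X²] Ω)
    (p≤p+q (Var[_] Ω X) (𝔼[_] Ω X * 𝔼[_] Ω X) {{square-nonNeg (𝔼[_] Ω X)}})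

-- Pulls out the common factor so that a sum of natural numbers remains, to which `sum-Bₑ²≤`
-- applies.
Σ-scaled-square : (f : A → ℕ) (c : ℚ) (Ω : List A) →
  Σ[ Ω ] (λ ω → (fromℕ (f ω) * c) * (fromℕ (f ω) * c)) ≡
  fromℕ (sum (map (λ ω → f ω ℕ.* f ω) Ω)) * (c * c)
Σ-scaled-square f c [] = sym (ℚ.*-zeroˡ (c * c))
Σ-scaled-square f c (ω ∷ Ω) = begin
  (k * c) * (k * c) + Σ[ Ω ] (λ ω → (fromℕ (f ω) * c) * (fromℕ (f ω) * c))
    ≡⟨ cong (λ t → (k * c) * (k * c) + t) (Σ-scaled-square f c Ω) ⟩
  (k * c) * (k * c) + s * (c * c)
    ≡⟨ solve 3 (λ k c s → (k :* c) :* (k :* c) :+ s :* (c :* c) := (k :* k :+ s) :* (c :* c)) refl k c s ⟩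
  (k * k + s) * (c * c)
    ≡⟨ cong (λ t → (t + s) * (c * c)) (fromℕ-homo-* (f ω) (f ω)) ⟨
  (fromℕ (f ω ℕ.* f ω) + s) * (c * c)
    ≡⟨ cong (_* (c * c)) (fromℕ-homo-+ (f ω ℕ.* f ω) _) ⟨
  fromℕ (f ω ℕ.* f ω ℕ.+ sum (map (λ ω → f ω ℕ.* f ω) Ω)) * (c * c) ∎
  where
  open ≡-Reasoning
  open +-*-Solver
  k = fromℕ (f ω)
  s = fromℕ (sum (map (λ ω → f ω ℕ.* f ω) Ω))

-- The variance bound for edge sampling

open BipartiteGraph using (edges; m; B; pE; Y)

lemma7 : (G : BipartiteGraph) .{{_ : NonZero (m G)}} →
    Var[_] (edges G) (Y G) ≤ (+ m G / 4) * (fromℕ (B G) + fromℕ (pE G))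
lemma7 G = begin
  Var[_] (edges G) (Y G)                             ≤⟨ Var≤𝔼[X²] (Y G) (edges G) ⟩
  𝔼[_] (edges G) (λ e → Y G e * Y G e)               ≡⟨ cong (_* r) (Σ-scaled-square Bₑ c (edges G)) ⟩
  fromℕ (sum (map (λ e → Bₑ e ℕ.* Bₑ e) (edges G))) * (c * c) * r
    ≤⟨ ℚ.*-monoʳ-≤-nonNeg r {{ℚ.normalize-nonNeg 1 (m G)}}
         (ℚ.*-monoʳ-≤-nonNeg (c * c) {{square-nonNeg c}} (fromℕ-mono-≤ sum-Bₑ²≤)) ⟩
  fromℕ (4 ℕ.* (B G ℕ.+ pE G)) * (c * c) * r         ≡⟨ cong (λ t → t * (c * c) * r) (fromℕ-homo-* 4 (B G ℕ.+ pE G)) ⟩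
  (fromℕ 4 * fromℕ (B G ℕ.+ pE G)) * (c * c) * r     ≡⟨ cong (λ t → (fromℕ 4 * t) * (c * c) * r) (fromℕ-homo-+ (B G) (pE G)) ⟩
  -- Only one factor `c` is expanded: its quarter cancels the 4 and its `M` cancels `r`, while the
  -- other `c` is the factor of the final bound.
  (fromℕ 4 * T) * (c * c) * r                        ≡⟨ cong (λ t → (fromℕ 4 * T) * (c * t) * r) (n/4≡n*¼ (m G)) ⟩
  (fromℕ 4 * T) * (c * (M * (+ 1 / 4))) * r          ≡⟨ solve 4 (λ T c M r →
    (con (fromℕ 4) :* T) :* (c :* (M :* con (+ 1 / 4))) :* r := (M :* r) :* (c :* T)) refl T c M r ⟩
  (M * r) * (c * T)                                  ≡⟨ cong (_* (c * T)) (fromℕ-inverse (m G)) ⟩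
  1ℚ * (c * T)                                       ≡⟨ ℚ.*-identityˡ (c * T) ⟩
  c * T                                              ∎
  where
  open ℚ.≤-Reasoning
  open +-*-Solver
  open BipartiteGraph G using (Bₑ)
  open Butterflies G using (sum-Bₑ²≤)
  c = + m G / 4
  r = + 1 / m G
  M = fromℕ (m G)
  T = fromℕ (B G) + fromℕ (pE G)
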